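{- rATL is strictly more expressive than rCTL, in the following sense: (i) for every rCTL formula $\varphi$ there is an rATL formula $\varphi^\star$ such that $V(s,\varphi^\star)=V_{rCTL}(s,\varphi)$ for every Kripke structure $\mathcal{K}$ and every state $s$ of $\mathcal{K}$ (with $\varphi^\star$ evaluated in $\mathcal{S}_\mathcal{K}$); and (ii) there exists an rATL formula $\psi$ such that for no rCTL formula $\chi$ it holds that $V(s,\psi)=V_{rCTL}(s,\chi)$ for every concurrent game structure $\mathcal{S}$ and every state $s$ of $\mathcal{S}$, where $V_{rCTL}$ on a concurrent game structure is evaluated in its underlying Kripke structure.
   Context: Fix a finite set $\mathrm{AP}$ of atomic propositions. A concurrent game structure (CGS) is a tuple $\mathcal{S}=(St,Ag,Ac,\delta,\ell)$ where $St$ is a finite set of states, $Ag$ a finite set of agents, $Ac$ a finite set of actions, $\ell:St\to 2^{\mathrm{AP}}$ a labeling, and $\delta:St\times AV\to St$ a transition function, where $AV$ is the set of action vectors for $Ag$ (an action vector for $A\subseteq Ag$ is a map $A\to Ac$). A state $s'$ is a successor of $s$ if $s'=\delta(s,v)$ for some $v\in AV$. A path is an infinite sequence $\pi=s_0s_1s_2\cdots$ of states with $s_{n+1}$ a successor of $s_n$ for all $n$; write $\pi[n]=s_n$. A strategy for an agent is a function $f:St^+\to Ac$. For $A\subseteq Ag$ and a set $F_A=\{f_a\mid a\in A\}$ of strategies, one for each agent in $A$, $out(s,F_A)$ is the set of paths $s_0s_1\cdots$ with $s_0=s$ such that for every $n\ge 0$ there is $v\in AV$ with $v(a)=f_a(s_0\cdots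 s_n)$ for all $a\in A$ and $s_{n+1}=\delta(s_n,v)$. $\mathbb{B}_4=\{1111,0111,0011,0001,0000\}$ is totally ordered by $1111\succ0111\succ0011\succ0001\succ0000$; for $b=b_1b_2b_3b_4\in\mathbb{B}_4$ and $k\in\{1,2,3,4\}$, $b[k]=b_k$; max and min on $\mathbb{B}_4$ refer to this order, and on bits to $0<1$. rATL formulas: state formulas $\varphi ::= p \mid \neg\varphi\mid\varphi\vee\varphi\mid\varphi\wedge\varphi\mid\varphi\to\varphi\mid\langle\!\langle A\rangle\!\rangle\Phi\mid[\![A]\!]\Phi$ and path formulas $\Phi::=\dot{\bigcirc}\varphi\mid\dot\Diamond\varphi\mid\dot\Box\varphi$, with $p\in\mathrm{AP}$ and $A$ a set of agents; an rATL formula is a state formula. On a CGS the valuation $V$ maps (state, state formula) and (path, path formula) pairs to $\mathbb{B}_4$: $V(s,p)=1111$ if $p\in\ell(s)$ and $0000$ otherwise; $V(s,\varphi_1\vee\varphi_2)=\max(V(s,\varphi_1),V(s,\varphi_2))$; $V(s,\varphi_1\wedge\varphi_2)=\min(V(s,\varphi_1),V(s,\varphi_2))$; $V(s,\neg\varphi)=0000$ if $V(s,\varphi)=1111$ and $1111$ otherwise; $V(s,\varphi_1\to\varphi_2)=1111$ if $V(s,\varphi_1)\preceq V(s,\varphi_2)$ and $V(s,\varphi_2)$ otherwise; $V(s,\langle\!\langle A\rangle\!\rangle\Phi)$ is the maximal $b\in\mathbb{B}_4$ such that there is a set $F_A$ of strategies (one per agent in $A$) with $V(\pi,\Phi)\succeq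 b$ for all $\pi\in out(s,F_A)$; $V(s,[\![A]\!]\Phi)$ is the maximal $b\in\mathbb{B}_4$ such that for every such $F_A$ there is $\pi\in out(s,F_A)$ with $V(\pi,\Phi)\succeq b$. For paths: $V(\pi,\dot\bigcirc\varphi)[k]=V(\pi[1],\varphi)[k]$; $V(\pi,\dot\Diamond\varphi)[k]=\max_{i\ge0}V(\pi[i],\varphi)[k]$; $V(\pi,\dot\Box\varphi)=b_1b_2b_3b_4$ with $b_1=\min_{i\ge0}V(\pi[i],\varphi)[1]$, $b_2=\max_{i\ge0}\min_{j\ge i}V(\pi[j],\varphi)[2]$, $b_3=\min_{i\ge0}\max_{j\ge i}V(\pi[j],\varphi)[3]$, $b_4=\max_{i\ge0}V(\pi[i],\varphi)[4]$. A Kripke structure is $\mathcal{K}=(S,I,R,L)$ with finite state set $S$, initial states $I\subseteq S$, transition relation $R\subseteq S\times S$ such that every state has an $R$-successor, and labeling $L:S\to2^{\mathrm{AP}}$; a path is an infinite sequence $s_0s_1\cdots$ with $(s_i,s_{i+1})\in R$; $\mathit{paths}(s)$ is the set of paths starting in $s$. rCTL formulas: state formulas $\varphi::=p\mid\neg\varphi\mid\varphi\vee\varphi\mid\varphi\wedge\varphi\mid\varphi\to\varphi\mid\exists\Phi\mid\forall\Phi$, path formulas $\Phi::=\dot\bigcirc\varphi\mid\dot\Diamond\varphi\mid\dot\Box\varphi$. The valuation $V_{rCTL}$ is defined exactly as $V$ above for atomic propositions, Boolean connectives and $\dot\bigcirc,\dot\Diamond,\dot\Box$ (with $L$ in place of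 $\ell$), and $V_{rCTL}(s,\exists\Phi)=\max_{\pi\in\mathit{paths}(s)}V_{rCTL}(\pi,\Phi)$, $V_{rCTL}(s,\forall\Phi)=\min_{\pi\in\mathit{paths}(s)}V_{rCTL}(\pi,\Phi)$. The underlying Kripke structure of a CGS $\mathcal{S}$ has the same states and labeling, with $R=\{(s,s')\mid s'\text{ is a successor of }s\}$. The CGS associated with $\mathcal{K}$ is $\mathcal{S}_\mathcal{K}=(S,\{a\},S,\delta,L)$ with a single agent $a$, actions $S$, and $\delta(s,s')=s'$ if $(s,s')\in R$, and $\delta(s,s')=s''$ for some fixed $s''$ with $(s,s'')\in R$ otherwise (action vectors for $\{a\}$ are identified with actions). -}

module Defs where

open import Axiom.ExcludedMiddle using (ExcludedMiddle)
open import Data.Bool.Base as Bool using (Bool; true; false; if_then_else_; f≤t; b≤b)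
open import Data.Bool.Properties as Bool using ()
open import Data.Fin.Base using (Fin; zero; suc; fromℕ<)
open import Data.Fin.Patterns using (0F; 1F; 2F; 3F)
open import Data.Fin.Subset using (Subset; _∈_; ⊤)
open import Data.Fin.Subset.Properties using (_∈?_)
open import Data.List.Base using (applyUpTo)
open import Data.List.NonEmpty.Base using (List⁺; _∷_)
open import Data.Nat.Base as ℕ using (ℕ; zero; suc; NonZero; _≥_; >-nonZero⁻¹)
import Data.Nat.Properties as ℕ
open import Data.Product.Base using (Σ; ∃; _×_; _,_; proj₁; proj₂)
open import Data.Vec.Base using (Vec; lookup; head; replicate)
open import Level using (0ℓ)
open import Relation.Binary.Core using (Rel)
open import Relation.Binary.PropositionalEquality using (_≡_; refl)
open import Relation.Nullary.Decidable.Core using (Dec; yes; no; does)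
open import Relation.Nullary.Negation.Core using (contradiction)

------------------------------------------------------------------------
-- Truth values

data 𝔹₄ : Set where
  1111₂ 0111₂ 0011₂ 0001₂ 0000₂ : 𝔹₄

-- Bits are indexed from 0: the k-th bit of the usual notation is b [ k - 1 ].
_[_] : 𝔹₄ → Fin 4 → Bool
1111₂ [ _ ] = true
0111₂ [ 0F ] = false
0111₂ [ suc _ ] = true
0011₂ [ 0F ] = false
0011₂ [ 1F ] = false
0011₂ [ suc (suc _) ] = true
0001₂ [ 0F ] = false
0001₂ [ 1F ] = false
0001₂ [ 2F ] = false
0001₂ [ 3F ] = true
0000₂ [ _ ] = false

rank : 𝔹₄ → ℕ
rank 1111₂ = 4
rank 0111₂ = 3
rank 0011₂ = 2
rank 0001₂ = 1
rank 0000₂ = 0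

infix 4 _⪯_ _⪰_ _⪯?_

_⪯_ _⪰_ : 𝔹₄ → 𝔹₄ → Set
b ⪯ c = rank b ℕ.≤ rank c
b ⪰ c = c ⪯ b

_⪯?_ : ∀ b c → Dec (b ⪯ c)
b ⪯? c = rank b ℕ.≤? rank c

max min : 𝔹₄ → 𝔹₄ → 𝔹₄
max b c = if does (b ⪯? c) then c else b
min b c = if does (b ⪯? c) then b else c

neg : 𝔹₄ → 𝔹₄
neg 1111₂ = 0000₂
neg _     = 1111₂

imp : 𝔹₄ → 𝔹₄ → 𝔹₄
imp b c = if does (b ⪯? c) then 1111₂ else c

-- A string of four bits denotes an element of 𝔹₄ exactly when it is
-- nondecreasing from left to right.
Nondecreasing : (Fin 4 → Bool) → Set
Nondecreasing b = b 0F Bool.≤ b 1F × b 1F Bool.≤ b 2F × b 2F Bool.≤ b 3F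

pack : ∀ b₁ b₂ b₃ b₄ → b₁ Bool.≤ b₂ → b₂ Bool.≤ b₃ → b₃ Bool.≤ b₄ → 𝔹₄
pack true  true  true  true  _  _  _  = 1111₂
pack false true  true  true  _  _  _  = 0111₂
pack false false true  true  _  _  _  = 0011₂
pack false false false true  _  _  _  = 0001₂
pack false false false false _  _  _  = 0000₂
pack true  false _     _     () _  _
pack _     true  false _     _  () _
pack _     _     true  false _  _  ()

fromBits : (b : Fin 4 → Bool) → Nondecreasing b → 𝔹₄
fromBits b (p , q , r) = pack (b 0F) (b 1F) (b 2F) (b 3F) p q r

[]-nondecreasing : ∀ c → Nondecreasing (c [_])
[]-nondecreasing 1111₂ = b≤b , b≤b , b≤b
[]-nondecreasing 0111₂ = f≤t , b≤b , b≤b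
[]-nondecreasing 0011₂ = b≤b , f≤t , b≤b
[]-nondecreasing 0001₂ = b≤b , b≤b , f≤t
[]-nondecreasing 0000₂ = b≤b , b≤b , b≤b

------------------------------------------------------------------------
-- Structures

-- The finite sets of states, agents, actions and atomic propositions are
-- of the form Fin n.

module _ {n : ℕ} where

  record Path (R : Rel (Fin n) 0ℓ) : Set where
    constructor mkPath
    infixl 9 _at_
    field
      _at_ : ℕ → Fin n
      step : ∀ i → R (_at_ i) (_at_ (suc i))

  -- The nonempty word s₀ s₁ ⋯ sᵢ, in this order.
  history : (ℕ → Fin n) → ℕ → List⁺ (Fin n)
  history π i = π 0 ∷ applyUpTo (λ j → π (suc j)) i

open Path public

-- A nonempty set of actions ensures that strategies and successors exist.
record CGS (AP agents : ℕ) : Set where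
  field
    states actions : ℕ
    {{states-nonZero}}  : NonZero states
    {{actions-nonZero}} : NonZero actions

  St = Fin states
  Ac = Fin actions
  AV = Vec Ac agents

  field
    δ : St → AV → St
    ℓ : St → Subset AP

  Successor : Rel St 0ℓ
  Successor s s′ = ∃ λ (v : AV) → s′ ≡ δ s v

  Strategy : Set
  Strategy = List⁺ St → Ac

  Strategies : Subset agents → Set
  Strategies A = ∀ a → a ∈ A → Strategy

  Out : (s : St) {A : Subset agents} → Strategies A → Path Successor → Set
  Out s {A} F π =
    π at 0 ≡ s ×
    (∀ i → ∃ λ (v : AV) →
      (∀ a (a∈A : a ∈ A) → lookup v a ≡ F a a∈A (history (π at_) i)) ×
      π at suc i ≡ δ (π at i) v)

record Kripke (AP : ℕ) : Set₁ where
  field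
    states : ℕ
    {{states-nonZero}} : NonZero states

  S = Fin states

  field
    I      : Subset states
    R      : Rel S 0ℓ
    serial : ∀ s → ∃ λ s′ → R s s′
    L      : S → Subset AP

  PathFrom : S → Set
  PathFrom s = Σ (Path R) λ π → π at 0 ≡ s

-- Initial states play no role in the semantics; all states are taken to
-- be initial.
underlying : ∀ {AP agents} → CGS AP agents → Kripke AP
underlying {agents = agents} 𝒮 = record
  { states = states
  ; I      = ⊤
  ; R      = Successor
  ; serial = λ s → δ s v₀ , v₀ , refl
  ; L      = ℓ
  }
  where
  open CGS 𝒮
  v₀ : AV
  v₀ = replicate agents (fromℕ< (>-nonZero⁻¹ actions))

------------------------------------------------------------------------
-- Syntax

infix 8 ◯̇_ ◇̇_ □̇_

data PathFormula (X : Set) : Set where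
  ◯̇_ ◇̇_ □̇_ : X → PathFormula X

module _ (AP : ℕ) where

  infix  8 ∼_
  infixr 7 _∧̇_
  infixr 6 _∨̇_
  infixr 5 _⇒_

  data rATL (agents : ℕ) : Set where
    atom           : Fin AP → rATL agents
    ∼_             : rATL agents → rATL agents
    _∨̇_ _∧̇_ _⇒_    : rATL agents → rATL agents → rATL agents
    ⟪_⟫_ ⟦_⟧_      : Subset agents → PathFormula (rATL agents) → rATL agents

  data rCTL : Set where
    atom           : Fin AP → rCTL
    ∼_             : rCTL → rCTL
    _∨̇_ _∧̇_ _⇒_    : rCTL → rCTL → rCTL
    ∃̇_ ∀̇_          : PathFormula rCTL → rCTL

------------------------------------------------------------------------
-- Semantics

-- Suprema over infinite index sets make the valuations total functions
-- into 𝔹₄ only under classical logic, hence the parameter.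
module Semantics (em : ExcludedMiddle 0ℓ) where

  holds : Set → Bool
  holds P = does (em {P})

  ⋁ ⋀ : {J : Set} → (J → Bool) → Bool
  ⋁ f = holds (∃ λ j → f j ≡ true)
  ⋀ f = holds (∀ j → f j ≡ true)

  -- The last branches need no test: whenever some element satisfies P, the
  -- one remaining there does.
  maximal minimal : (𝔹₄ → Set) → 𝔹₄
  maximal P =
    if holds (P 1111₂) then 1111₂ else
    if holds (P 0111₂) then 0111₂ else
    if holds (P 0011₂) then 0011₂ else
    if holds (P 0001₂) then 0001₂ else
    0000₂
  minimal P =
    if holds (P 0000₂) then 0000₂ else
    if holds (P 0001₂) then 0001₂ else
    if holds (P 0011₂) then 0011₂ else
    if holds (P 0111₂) then 0111₂ else
    1111₂

  Max Min : {J : Set} → (J → 𝔹₄) → 𝔹₄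
  Max f = maximal λ b → ∃ λ j → f j ≡ b
  Min f = minimal λ b → ∃ λ j → f j ≡ b

  holds-mono : {P Q : Set} → (P → Q) → holds P Bool.≤ holds Q
  holds-mono {P} {Q} f with em {P} | em {Q}
  ... | yes _ | yes _ = b≤b
  ... | yes p | no ¬q = contradiction (f p) ¬q
  ... | no _  | yes _ = f≤t
  ... | no _  | no _  = b≤b

  holds⁻ : {P : Set} → holds P ≡ true → P
  holds⁻ {P} e with em {P}
  holds⁻ _ | yes p = p

  holds⁺ : {P : Set} → P → holds P ≡ true
  holds⁺ {P} p with em {P}
  ... | yes _ = refl
  ... | no ¬p = contradiction p ¬p

  ≤-true : ∀ {b c} → b Bool.≤ c → b ≡ true → c ≡ true
  ≤-true b≤b e = e

  bit-0⇒1 : ∀ c → c [ 0F ] ≡ true → c [ 1F ] ≡ true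
  bit-0⇒1 c = ≤-true (proj₁ ([]-nondecreasing c))

  bit-1⇒2 : ∀ c → c [ 1F ] ≡ true → c [ 2F ] ≡ true
  bit-1⇒2 c = ≤-true (proj₁ (proj₂ ([]-nondecreasing c)))

  bit-2⇒3 : ∀ c → c [ 2F ] ≡ true → c [ 3F ] ≡ true
  bit-2⇒3 c = ≤-true (proj₂ (proj₂ ([]-nondecreasing c)))

  -- Values of path formulas, where f i is the value of the immediate
  -- subformula at position i of the path.

  next eventually always : (ℕ → 𝔹₄) → 𝔹₄
  eventuallyBits alwaysBits : (ℕ → 𝔹₄) → Fin 4 → Bool

  next f = f 1

  eventuallyBits f k = ⋁ λ i → f i [ k ]

  alwaysBits f 0F = ⋀ λ i → f i [ 0F ]
  alwaysBits f 1F = ⋁ λ i → ⋀ λ ((j , _) : ∃ λ j → j ≥ i) → f j [ 1F ]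
  alwaysBits f 2F = ⋀ λ i → ⋁ λ ((j , _) : ∃ λ j → j ≥ i) → f j [ 2F ]
  alwaysBits f 3F = ⋁ λ i → f i [ 3F ]

  eventually f = fromBits (eventuallyBits f)
    ( holds-mono (λ (i , e) → i , bit-0⇒1 (f i) e)
    , holds-mono (λ (i , e) → i , bit-1⇒2 (f i) e)
    , holds-mono (λ (i , e) → i , bit-2⇒3 (f i) e)
    )

  always f = fromBits (alwaysBits f)
    ( holds-mono (λ e → 0 , holds⁺ λ (j , _) → bit-0⇒1 (f j) (e j))
    , holds-mono (λ (i , e) i′ → holds⁺
        ( (i ℕ.⊔ i′ , ℕ.m≤n⊔m i i′)
        , bit-1⇒2 (f (i ℕ.⊔ i′)) (holds⁻ e (i ℕ.⊔ i′ , ℕ.m≤m⊔n i i′))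
        ))
    , holds-mono (λ e → let ((j , _) , e′) = holds⁻ (e 0) in j , bit-2⇒3 (f j) e′)
    )

  atomic : ∀ {AP} → Fin AP → Subset AP → 𝔹₄
  atomic p X = if does (p ∈? X) then 1111₂ else 0000₂

  module _ {AP agents : ℕ} (𝒮 : CGS AP agents) where
    open CGS 𝒮

    V     : St → rATL AP agents → 𝔹₄
    Vpath : Path Successor → PathFormula (rATL AP agents) → 𝔹₄

    V s (atom p)  = atomic p (ℓ s)
    V s (∼ φ)     = neg (V s φ)
    V s (φ ∨̇ χ)   = max (V s φ) (V s χ)
    V s (φ ∧̇ χ)   = min (V s φ) (V s χ)
    V s (φ ⇒ χ)   = imp (V s φ) (V s χ)
    V s (⟪ A ⟫ Φ) = maximal λ b →
      ∃ λ (F : Strategies A) → ∀ π → Out s F π → Vpath π Φ ⪰ b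
    V s (⟦ A ⟧ Φ) = maximal λ b →
      ∀ (F : Strategies A) → ∃ λ π → Out s F π × Vpath π Φ ⪰ b

    Vpath π (◯̇ φ) = next       λ i → V (π at i) φ
    Vpath π (◇̇ φ) = eventually λ i → V (π at i) φ
    Vpath π (□̇ φ) = always     λ i → V (π at i) φ

  module _ {AP : ℕ} (𝒦 : Kripke AP) where
    open Kripke 𝒦

    VrCTL     : S → rCTL AP → 𝔹₄
    VrCTLpath : Path R → PathFormula (rCTL AP) → 𝔹₄

    VrCTL s (atom p) = atomic p (L s)
    VrCTL s (∼ φ)    = neg (VrCTL s φ)
    VrCTL s (φ ∨̇ χ)  = max (VrCTL s φ) (VrCTL s χ)
    VrCTL s (φ ∧̇ χ)  = min (VrCTL s φ) (VrCTL s χ)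
    VrCTL s (φ ⇒ χ)  = imp (VrCTL s φ) (VrCTL s χ)
    VrCTL s (∃̇ Φ)    = Max λ ((π , _) : PathFrom s) → VrCTLpath π Φ
    VrCTL s (∀̇ Φ)    = Min λ ((π , _) : PathFrom s) → VrCTLpath π Φ

    VrCTLpath π (◯̇ φ) = next       λ i → VrCTL (π at i) φ
    VrCTLpath π (◇̇ φ) = eventually λ i → VrCTL (π at i) φ
    VrCTLpath π (□̇ φ) = always     λ i → VrCTL (π at i) φ

  -- The default successor of s is the one recorded in the proof that R is
  -- serial.
  associated : ∀ {AP} → Kripke AP → CGS AP 1
  associated 𝒦 = record
    { states  = states
    ; actions = states
    ; δ       = λ s v → if holds (R s (head v)) then head v else proj₁ (serial s)
    ; ℓ       = L
    }
    where open Kripke 𝒦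

{-# OPTIONS --safe #-}
-- For the empty coalition, Out s F consists of all paths from s, so ⟦∅⟧ and
-- ⟪∅⟫ quantify existentially and universally over paths, as ∃ and ∀ do in
-- rCTL.  Conversely, rCTL sees only which transitions are possible, not who
-- decides about them: if the next state is the move of one of two agents, then
-- it depends on the choice of that agent whether the first one can enforce ◯̇ p,
-- although the underlying transition relations agree.
module Submission where

open import Defs
open import Axiom.ExcludedMiddle using (ExcludedMiddle)
open import Data.Bool.Base using (Bool; if_then_else_)
import Data.Bool.Properties as Bool
open import Data.Fin.Base using (Fin; fromℕ<)
open import Data.Fin.Patterns using (0F; 1F; 2F; 3F)
open import Data.Fin.Subset using (Subset; _∈_; ⊥; ⊤; ⁅_⁆)
open import Data.Fin.Subset.Properties using (∉⊥; ∈⊤; x∈⁅x⁆; _∈?_)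
open import Data.List.Base using (List; []; _∷_)
open import Data.List.Membership.Propositional using () renaming (_∈_ to _∈ₗ_)
import Data.List.Relation.Unary.All as All
open import Data.List.Relation.Unary.AllPairs using (AllPairs; _∷_; allPairs?)
open import Data.List.Relation.Unary.Any using (here; there)
open import Data.Nat.Base as ℕ using (ℕ; NonZero; >-nonZero⁻¹)
import Data.Nat.Properties as ℕ
open import Data.Product.Base using (∃; _×_; _,_; proj₁; proj₂)
open import Data.Vec.Base using ([]; _∷_; here; there; head; lookup; replicate)
open import Data.Vec.Properties using (lookup-replicate)
open import Level using (0ℓ)
open import Relation.Binary.Core using (Rel) renaming (_⇒_ to _⊆ᵣ_)
open import Relation.Binary.Definitions using (Reflexive)
open import Relation.Binary.PropositionalEquality
  using (_≡_; _≢_; refl; sym; trans; cong; cong₂; subst; module ≡-Reasoning)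
open import Relation.Nullary.Decidable using (yes; no; from-yes; dec-true; dec-false)
open import Relation.Nullary.Negation.Core using (¬_; contradiction)

-- Order and bits of the truth values.

rank-injective : ∀ b c → rank b ≡ rank c → b ≡ c
rank-injective 1111₂ 1111₂ _ = refl
rank-injective 0111₂ 0111₂ _ = refl
rank-injective 0011₂ 0011₂ _ = refl
rank-injective 0001₂ 0001₂ _ = refl
rank-injective 0000₂ 0000₂ _ = refl

⪯-antisym : ∀ {b c} → b ⪯ c → c ⪯ b → b ≡ c
⪯-antisym p q = rank-injective _ _ (ℕ.≤-antisym p q)

ascending descending : List 𝔹₄
ascending  = 0000₂ ∷ 0001₂ ∷ 0011₂ ∷ 0111₂ ∷ 1111₂ ∷ []
descending = 1111₂ ∷ 0111₂ ∷ 0011₂ ∷ 0001₂ ∷ 0000₂ ∷ []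

∈-ascending : ∀ b → b ∈ₗ ascending
∈-ascending 0000₂ = here refl
∈-ascending 0001₂ = there (here refl)
∈-ascending 0011₂ = there (there (here refl))
∈-ascending 0111₂ = there (there (there (here refl)))
∈-ascending 1111₂ = there (there (there (there (here refl))))

∈-descending : ∀ b → b ∈ₗ descending
∈-descending 1111₂ = here refl
∈-descending 0111₂ = there (here refl)
∈-descending 0011₂ = there (there (here refl))
∈-descending 0001₂ = there (there (there (here refl)))
∈-descending 0000₂ = there (there (there (there (here refl))))

1111₂-max : ∀ b → b ⪯ 1111₂
1111₂-max b = All.lookup (from-yes (All.all? (_⪯? 1111₂) ascending)) (∈-ascending b)

-- `Bool.≤` is proof-irrelevant, so only the four bits matter. Agreement bit by bit is assumed
-- because equality of bit functions would call for function extensionality.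
fromBits-cong : ∀ {b c} (p : Nondecreasing b) (q : Nondecreasing c) →
  (∀ k → b k ≡ c k) → fromBits b p ≡ fromBits c q
fromBits-cong {b} {c} (p₁ , p₂ , p₃) (q₁ , q₂ , q₃) b≗c =
  pack-cong (b≗c _) (b≗c _) (b≗c _) (b≗c _) p₁ p₂ p₃ q₁ q₂ q₃
  where
  pack-cong : ∀ {b₁ b₂ b₃ b₄ c₁ c₂ c₃ c₄} →
    b₁ ≡ c₁ → b₂ ≡ c₂ → b₃ ≡ c₃ → b₄ ≡ c₄ → ∀ p₁ p₂ p₃ q₁ q₂ q₃ →
    pack b₁ b₂ b₃ b₄ p₁ p₂ p₃ ≡ pack c₁ c₂ c₃ c₄ q₁ q₂ q₃
  pack-cong refl refl refl refl p₁ p₂ p₃ q₁ q₂ q₃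
    rewrite Bool.≤-irrelevant p₁ q₁
          | Bool.≤-irrelevant p₂ q₂
          | Bool.≤-irrelevant p₃ q₃ = refl

-- Paths in Kripke structures.

mapPath : ∀ {n} {Q Q′ : Rel (Fin n) 0ℓ} → Q ⊆ᵣ Q′ → Path Q → Path Q′
mapPath Q⇒Q′ π = mkPath (π at_) λ i → Q⇒Q′ (step π i)

module _ {AP : ℕ} (𝒦 : Kripke AP) where
  open Kripke 𝒦

  -- Guarantees that path quantifiers range over an inhabited set, so that their extrema are
  -- attained.
  pathFrom : ∀ s → PathFrom s
  pathFrom s = mkPath visit (λ i → proj₂ (serial (visit i))) , refl
    where
    visit : ℕ → S
    visit ℕ.zero    = s
    visit (ℕ.suc i) = proj₁ (serial (visit i))

-- Translation of rCTL into rATL.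

module _ {AP agents : ℕ} where

  toATL     : rCTL AP → rATL AP agents
  toATLpath : PathFormula (rCTL AP) → PathFormula (rATL AP agents)

  toATL (atom p) = atom p
  toATL (∼ φ)    = ∼ toATL φ
  toATL (φ ∨̇ χ)  = toATL φ ∨̇ toATL χ
  toATL (φ ∧̇ χ)  = toATL φ ∧̇ toATL χ
  toATL (φ ⇒ χ)  = toATL φ ⇒ toATL χ
  toATL (∃̇ Φ)    = ⟦ ⊥ ⟧ toATLpath Φ
  toATL (∀̇ Φ)    = ⟪ ⊥ ⟫ toATLpath Φ

  toATLpath (◯̇ φ) = ◯̇ toATL φ
  toATLpath (◇̇ φ) = ◇̇ toATL φ
  toATLpath (□̇ φ) = □̇ toATL φ

module _ (em : ExcludedMiddle 0ℓ) where
  open Semantics em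

  -- Congruence of the temporal operators.

  holds-cong : {P Q : Set} → (P → Q) → (Q → P) → holds P ≡ holds Q
  holds-cong f g = Bool.≤-antisym (holds-mono f) (holds-mono g)

  ⋁-cong : {J : Set} {f g : J → Bool} → (∀ j → f j ≡ g j) → ⋁ f ≡ ⋁ g
  ⋁-cong f≗g = holds-cong
    (λ (j , e) → j , trans (sym (f≗g j)) e)
    (λ (j , e) → j , trans (f≗g j) e)

  ⋀-cong : {J : Set} {f g : J → Bool} → (∀ j → f j ≡ g j) → ⋀ f ≡ ⋀ g
  ⋀-cong f≗g = holds-cong
    (λ e j → trans (sym (f≗g j)) (e j))
    (λ e j → trans (f≗g j) (e j))

  module _ {f g : ℕ → 𝔹₄} (f≗g : ∀ i → f i ≡ g i) where

    bit-cong : ∀ k i → f i [ k ] ≡ g i [ k ]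
    bit-cong k i = cong (_[ k ]) (f≗g i)

    eventually-cong : eventually f ≡ eventually g
    eventually-cong = fromBits-cong {b = eventuallyBits f} {c = eventuallyBits g} _ _
      λ k → ⋁-cong (bit-cong k)

    always-cong : always f ≡ always g
    always-cong = fromBits-cong {b = alwaysBits f} {c = alwaysBits g} _ _ λ where
      0F → ⋀-cong (bit-cong _)
      1F → ⋁-cong λ i → ⋀-cong λ (j , _) → bit-cong _ j
      2F → ⋀-cong λ i → ⋁-cong λ (j , _) → bit-cong _ j
      3F → ⋁-cong (bit-cong _)

  -- Extremal truth values.

  module _ (P : 𝔹₄ → Set) where

    -- Definitionally, minimal and maximal run through ascending and descending.
    first : 𝔹₄ → List 𝔹₄ → 𝔹₄
    first c []       = c
    first c (d ∷ ds) = if holds (P c) then c else first d ds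

    -- The scan stops at the first element satisfying `P`, and sortedness puts it before all later
    -- ones. The order is a parameter so that `⪯` and its converse are both covered.
    first-extremal : {_≼_ : Rel 𝔹₄ 0ℓ} → Reflexive _≼_ → ∀ {b} c cs →
      AllPairs _≼_ (c ∷ cs) → b ∈ₗ c ∷ cs → P b →
      P (first c cs) × first c cs ≼ b
    -- The last element is returned untested; here membership identifies it with `b`, which
    -- satisfies `P`.
    first-extremal ≼-refl c [] _ (here refl) p = p , ≼-refl
    first-extremal ≼-refl c (d ∷ ds) (c≼ ∷ sorted) b∈ p with em {P c} | b∈
    ... | yes q | here refl = q , ≼-refl
    ... | yes q | there b∈′ = q , All.lookup c≼ b∈′
    ... | no ¬q | here refl = contradiction p ¬q
    ... | no ¬q | there b∈′ = first-extremal ≼-refl d ds sorted b∈′ p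

    minimal-extremal : ∀ {b} → P b → P (minimal P) × minimal P ⪯ b
    minimal-extremal {b} = first-extremal ℕ.≤-refl _ _
      (from-yes (allPairs? _⪯?_ ascending)) (∈-ascending b)

    maximal-extremal : ∀ {b} → P b → P (maximal P) × maximal P ⪰ b
    maximal-extremal {b} = first-extremal ℕ.≤-refl _ _
      (from-yes (allPairs? (λ c d → d ⪯? c) descending)) (∈-descending b)

    maximal-unique : ∀ {m} → P m → (∀ b → P b → b ⪯ m) → maximal P ≡ m
    maximal-unique p upper = let q , m⪯ = maximal-extremal p in
      ⪯-antisym (upper _ q) m⪯

  module _ {J : Set} (f : J → 𝔹₄) where

    Value : 𝔹₄ → Set
    Value b = ∃ λ j → f j ≡ b

    -- The argument ensures that there is a value at all: over an empty index set, `Max f` is the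
    -- default `0000₂`, which is not attained.
    Max-attained : J → Value (Max f)
    Max-attained j = proj₁ (maximal-extremal Value (j , refl))

    Max-upper : ∀ j → f j ⪯ Max f
    Max-upper j = proj₂ (maximal-extremal Value (j , refl))

    Min-attained : J → Value (Min f)
    Min-attained j = proj₁ (minimal-extremal Value (j , refl))

    Min-lower : ∀ j → Min f ⪯ f j
    Min-lower j = proj₂ (minimal-extremal Value (j , refl))

  module _ {J K : Set} {f : J → 𝔹₄} {g : K → 𝔹₄}
    (to : ∀ j → ∃ λ k → g k ≡ f j) (from : ∀ k → ∃ λ j → f j ≡ g k) where

    -- Both families take the same values and hence pass the same tests in `maximal` and `minimal`.
    -- The index sets may differ, as they will be paths over different relations.
    value-cong : ∀ b → holds (Value f b) ≡ holds (Value g b)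
    value-cong b = holds-cong
      (λ (j , e) → let k , e′ = to j in k , trans e′ e)
      (λ (k , e) → let j , e′ = from k in j , trans e′ e)

    Max-cong : Max f ≡ Max g
    Max-cong
      rewrite value-cong 1111₂ | value-cong 0111₂
            | value-cong 0011₂ | value-cong 0001₂ = refl

    Min-cong : Min f ≡ Min g
    Min-cong
      rewrite value-cong 0000₂ | value-cong 0001₂
            | value-cong 0011₂ | value-cong 0111₂ = refl

  -- Invariance of rCTL under equivalent transition relations.

  module _ {AP : ℕ} (𝒦 : Kripke AP)
    {I′ : Subset (Kripke.states 𝒦)} {R′ : Rel (Kripke.S 𝒦) 0ℓ} (serial′ : ∀ s → ∃ (R′ s))
    (R⇒R′ : Kripke.R 𝒦 ⊆ᵣ R′) (R′⇒R : R′ ⊆ᵣ Kripke.R 𝒦) where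
    open Kripke 𝒦 using (R)

    private
      𝒦′ : Kripke AP
      𝒦′ = record 𝒦 { I = I′ ; R = R′ ; serial = serial′ }

    -- Mutually included relations admit the same state sequences as paths, although the types
    -- `Path R` and `Path R′` differ. Path formulas are therefore compared along paths that agree
    -- pointwise.
    VrCTL-cong : ∀ s φ → VrCTL 𝒦 s φ ≡ VrCTL 𝒦′ s φ
    VrCTLpath-cong : ∀ (π : Path R) (π′ : Path R′) Φ → (∀ i → π at i ≡ π′ at i) →
      VrCTLpath 𝒦 π Φ ≡ VrCTLpath 𝒦′ π′ Φ

    VrCTL-cong s (atom p) = refl
    VrCTL-cong s (∼ φ)    = cong neg (VrCTL-cong s φ)
    VrCTL-cong s (φ ∨̇ χ)  = cong₂ max (VrCTL-cong s φ) (VrCTL-cong s χ)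
    VrCTL-cong s (φ ∧̇ χ)  = cong₂ min (VrCTL-cong s φ) (VrCTL-cong s χ)
    VrCTL-cong s (φ ⇒ χ)  = cong₂ imp (VrCTL-cong s φ) (VrCTL-cong s χ)
    VrCTL-cong s (∃̇ Φ)    = Max-cong
      (λ (π , e) → (mapPath R⇒R′ π , e) , sym (VrCTLpath-cong _ _ Φ λ _ → refl))
      (λ (π , e) → (mapPath R′⇒R π , e) , VrCTLpath-cong _ _ Φ λ _ → refl)
    VrCTL-cong s (∀̇ Φ)    = Min-cong
      (λ (π , e) → (mapPath R⇒R′ π , e) , sym (VrCTLpath-cong _ _ Φ λ _ → refl))
      (λ (π , e) → (mapPath R′⇒R π , e) , VrCTLpath-cong _ _ Φ λ _ → refl)

    VrCTLpath-cong π π′ (◯̇ φ) π≗ =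
      trans (VrCTL-cong _ φ) (cong (λ t → VrCTL 𝒦′ t φ) (π≗ 1))
    VrCTLpath-cong π π′ (◇̇ φ) π≗ = eventually-cong λ i →
      trans (VrCTL-cong _ φ) (cong (λ t → VrCTL 𝒦′ t φ) (π≗ i))
    VrCTLpath-cong π π′ (□̇ φ) π≗ = always-cong λ i →
      trans (VrCTL-cong _ φ) (cong (λ t → VrCTL 𝒦′ t φ) (π≗ i))

  -- Correctness of the translation.

  module _ {AP agents : ℕ} (𝒮 : CGS AP agents) where
    open CGS 𝒮

    private
      noStrategies : Strategies ⊥
      noStrategies _ a∈⊥ = contradiction a∈⊥ ∉⊥

      -- The action vector recorded in each step of the path is the one required, as the empty
      -- coalition imposes no condition on it.
      out-⊥ : ∀ {s} (F : Strategies ⊥) π → π at 0 ≡ s → Out s F π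
      out-⊥ _ π e = e , λ i → let v , e′ = step π i in
        v , (λ _ a∈⊥ → contradiction a∈⊥ ∉⊥) , e′

    -- Proved for every concurrent game structure; the case of a Kripke structure follows once
    -- `associated 𝒦` is seen to have the transitions of `𝒦`.
    V-toATL : ∀ s φ → V 𝒮 s (toATL φ) ≡ VrCTL (underlying 𝒮) s φ
    Vpath-toATLpath : ∀ π Φ →
      Vpath 𝒮 π (toATLpath Φ) ≡ VrCTLpath (underlying 𝒮) π Φ

    V-toATL s (atom p) = refl
    V-toATL s (∼ φ)    = cong neg (V-toATL s φ)
    V-toATL s (φ ∨̇ χ)  = cong₂ max (V-toATL s φ) (V-toATL s χ)
    V-toATL s (φ ∧̇ χ)  = cong₂ min (V-toATL s φ) (V-toATL s χ)
    V-toATL s (φ ⇒ χ)  = cong₂ imp (V-toATL s φ) (V-toATL s χ)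
    V-toATL s (∃̇ Φ)    = maximal-unique
      (λ b → ∀ (F : Strategies ⊥) → ∃ λ π → Out s F π × Vpath 𝒮 π (toATLpath Φ) ⪰ b)
      -- A path attaining the maximum is an outcome of every `F`.
      (λ F → let (π , e) , attained = Max-attained _ (pathFrom (underlying 𝒮) s) in
        π , out-⊥ F π e , ℕ.≤-reflexive (cong rank (sym (trans (Vpath-toATLpath π Φ) attained))))
      (λ b unavoidable → let π , (e , _) , b⪯ = unavoidable noStrategies in
        ℕ.≤-trans (subst (b ⪯_) (Vpath-toATLpath π Φ) b⪯) (Max-upper _ (π , e)))
    V-toATL s (∀̇ Φ)    = maximal-unique
      (λ b → ∃ λ (F : Strategies ⊥) → ∀ π → Out s F π → Vpath 𝒮 π (toATLpath Φ) ⪰ b)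
      (noStrategies , λ π (e , _) →
        subst (_ ⪯_) (sym (Vpath-toATLpath π Φ)) (Min-lower _ (π , e)))
      -- A path attaining the minimum is an outcome of `F`, so its value bounds whatever `F`
      -- enforces.
      (λ b (F , enforced) →
        let (π , e) , attained = Min-attained _ (pathFrom (underlying 𝒮) s) in
        subst (b ⪯_) (trans (Vpath-toATLpath π Φ) attained) (enforced π (out-⊥ F π e)))

    Vpath-toATLpath π (◯̇ φ) = V-toATL _ φ
    Vpath-toATLpath π (◇̇ φ) = eventually-cong λ i → V-toATL _ φ
    Vpath-toATLpath π (□̇ φ) = always-cong λ i → V-toATL _ φ

  -- The game structure associated with a Kripke structure.

  module _ {AP : ℕ} (𝒦 : Kripke AP) where
    open Kripke 𝒦 using (R; serial)
    open CGS (associated 𝒦) using (Successor)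

    R⇒Successor : R ⊆ᵣ Successor
    R⇒Successor {s} {s′} r = s′ ∷ [] , eq
      where
      eq : s′ ≡ CGS.δ (associated 𝒦) s (s′ ∷ [])
      eq rewrite holds⁺ r = refl

    Successor⇒R : Successor ⊆ᵣ R
    Successor⇒R {s} (v , refl) with em {R s (head v)}
    ... | yes r = r
    -- An illegal move is redirected to the default successor, which `serial` relates to `s`.
    ... | no _  = proj₂ (serial s)

    V-associated : ∀ s φ → V (associated 𝒦) s (toATL φ) ≡ VrCTL 𝒦 s φ
    V-associated s φ = trans (V-toATL (associated 𝒦) s φ)
      (sym (VrCTL-cong 𝒦 _ R⇒Successor Successor⇒R s φ))

  -- A formula of rATL that rCTL cannot express.

  module _ {AP : ℕ} (p : Fin AP) where

    chooser : Fin 2 → CGS AP 2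
    chooser a = record
      { states  = 2
      ; actions = 2
      ; δ       = λ _ v → lookup v a
      ; ℓ       = lookup (⊥ ∷ ⊤ ∷ [])
      }

    -- If both agents choose `s′`, it is reached whoever decides. Thus the two structures have
    -- equivalent transition relations.
    chooser-complete : ∀ a s s′ → CGS.Successor (chooser a) s s′
    chooser-complete a _ s′ = replicate 2 s′ , sym (lookup-replicate a s′)

    canEnforce : rATL AP 2
    canEnforce = ⟪ ⁅ 0F ⁆ ⟫ (◯̇ atom p)

    Enforceable : Fin 2 → 𝔹₄ → Set
    Enforceable a b = ∃ λ (F : CGS.Strategies (chooser a) ⁅ 0F ⁆) →
      ∀ π → CGS.Out (chooser a) 0F F π → Vpath (chooser a) π (◯̇ atom p) ⪰ b

    chooser-0-enforces : V (chooser 0F) 0F canEnforce ≡ 1111₂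
    chooser-0-enforces = maximal-unique (Enforceable 0F)
      -- Agent `0F` decides here, so always playing `1F` puts position 1 of every outcome in the
      -- state where `p` holds.
      ( (λ _ _ _ → 1F)
      , λ π (_ , moves) → let _ , chosen , e = moves 0 in
          ℕ.≤-reflexive (cong rank (sym (reached (trans e (chosen 0F (x∈⁅x⁆ 0F))))))
      )
      (λ b _ → 1111₂-max b)
      where
      reached : ∀ {t} → t ≡ 1F → atomic p (CGS.ℓ (chooser 0F) t) ≡ 1111₂
      reached refl rewrite dec-true (p ∈? ⊤) ∈⊤ = refl

    chooser-1-prevents : V (chooser 1F) 0F canEnforce ≢ 1111₂
    chooser-1-prevents e =
      let F , enforced = subst (Enforceable 1F) e
            -- Some enforceable value is needed for the maximum to be enforceable; `0000₂` is
            -- enforced by any strategy.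
            (proj₁ (maximal-extremal (Enforceable 1F) {0000₂} ((λ _ _ _ → 0F) , λ _ _ → ℕ.z≤n)))
      in unreached (enforced (stay F) (refl , λ i → moves F i , agrees F i , refl))
      where
      open CGS (chooser 1F)

      module _ (F : Strategies ⁅ 0F ⁆) where

        moves : ℕ → AV
        moves i = F 0F (x∈⁅x⁆ 0F) (history (λ _ → 0F) i) ∷ 0F ∷ []

        stay : Path Successor
        stay = mkPath (λ _ → 0F) λ i → moves i , refl

        agrees : ∀ i a (a∈ : a ∈ ⁅ 0F ⁆) →
          lookup (moves i) a ≡ F a a∈ (history (stay at_) i)
        agrees i 0F here = refl
        agrees i 1F (there a∈⊥) = contradiction a∈⊥ ∉⊥

      unreached : ¬ atomic p ⊥ ⪰ 1111₂
      unreached rewrite dec-false (p ∈? ⊥) ∉⊥ = λ ()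

    canEnforce-inexpressible : ¬ (∃ λ (χ : rCTL AP) →
      ∀ (𝒮 : CGS AP 2) (s : CGS.St 𝒮) → V 𝒮 s canEnforce ≡ VrCTL (underlying 𝒮) s χ)
    canEnforce-inexpressible (χ , expresses) = chooser-1-prevents (begin
      V (chooser 1F) 0F canEnforce          ≡⟨ expresses (chooser 1F) 0F ⟩
      -- Both relations are complete, so each includes the other and `χ` cannot tell them apart.
      VrCTL (underlying (chooser 1F)) 0F χ  ≡⟨ VrCTL-cong (underlying (chooser 0F)) _
                                                 (λ {s s′} _ → chooser-complete 1F s s′)
                                                 (λ {s s′} _ → chooser-complete 0F s s′) 0F χ ⟨
      VrCTL (underlying (chooser 0F)) 0F χ  ≡⟨ expresses (chooser 0F) 0F ⟨
      V (chooser 0F) 0F canEnforce          ≡⟨ chooser-0-enforces ⟩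
      1111₂                                 ∎)
      where open ≡-Reasoning

theorem4 : (em : ExcludedMiddle 0ℓ) → (AP : ℕ) → .{{_ : NonZero AP}} →
    let open Semantics em in
    (∀ (φ : rCTL AP) → ∃ λ (φ⋆ : rATL AP 1) →
    ∀ (𝒦 : Kripke AP) (s : Kripke.S 𝒦) →
    V (associated 𝒦) s φ⋆ ≡ VrCTL 𝒦 s φ)
    ×
    (∃ λ (agents : ℕ) → ∃ λ (ψ : rATL AP agents) →
    ¬ (∃ λ (χ : rCTL AP) →
    ∀ (𝒮 : CGS AP agents) (s : CGS.St 𝒮) →
    V 𝒮 s ψ ≡ VrCTL (underlying 𝒮) s χ))
theorem4 em AP =
    (λ φ → toATL φ , λ 𝒦 s → V-associated em 𝒦 s φ)
  , 2 , canEnforce em p , canEnforce-inexpressible em p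
  where
  p : Fin AP
  p = fromℕ< (>-nonZero⁻¹ AP)
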